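{- The families of morphisms $f: I_{\mathsf{IntBiLat}}\to FG$ and $g: I_{\mathsf{Lat}}\to GF$ given by $f_{\mathbf B}(a)=\langle\mathrm{reg}(a),\mathrm{reg}(\neg a)\rangle$ for $a\in B$ and $g_{\mathbf L}(a)=\langle a,a\rangle$ for $a\in L$ are natural isomorphisms, so that the categories $\mathsf{Lat}$ and $\mathsf{IntBiLat}$ are naturally equivalent.
   Context: A bilattice is an algebra $\langle B,\land,\lor,\otimes,\oplus,\neg\rangle$ such that $\langle B,\land,\lor\rangle$ and $\langle B,\otimes,\oplus\rangle$ are lattices (not necessarily bounded) with orders $\leq_t$ and $\leq_k$, and $\neg$ is unary with: $a\leq_t b\Rightarrow\neg b\leq_t\neg a$; $a\leq_k b\Rightarrow\neg a\leq_k\neg b$; $\neg\neg a=a$. It is interlaced if each of $\land,\lor,\otimes,\oplus$ is monotone with respect to both $\leq_t$ and $\leq_k$. $\mathsf{IntBiLat}$ is the category of interlaced bilattices with all homomorphisms (preserving all five operations); $\mathsf{Lat}$ is the category of lattices with all lattice homomorphisms. $I_{\mathsf C}$ is the identity functor of $\mathsf C$. For an interlaced bilattice $\mathbf B$, $\mathrm{Reg}(\mathbf B)=\{a\in B: a=\neg a\}$, which is a sublattice of $\langle B,\otimes,\oplus\rangle$, and $\mathrm{reg}(a)=(a\lor(a\otimes\neg a))\oplus\neg(a\lor(a\otimes\neg a))\in\mathrm{Reg}(\mathbf B)$. For a lattice $\mathbf L=\langle L,\sqcap,\sqcup\rangle$, the interlaced bilattice $\mathbf L\odot\mathbf L$ has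 universe $L\times L$ and operations $\langle a_1,a_2\rangle\land\langle b_1,b_2\rangle=\langle a_1\sqcap b_1,a_2\sqcup b_2\rangle$, $\langle a_1,a_2\rangle\lor\langle b_1,b_2\rangle=\langle a_1\sqcup b_1,a_2\sqcap b_2\rangle$, $\langle a_1,a_2\rangle\otimes\langle b_1,b_2\rangle=\langle a_1\sqcap b_1,a_2\sqcap b_2\rangle$, $\langle a_1,a_2\rangle\oplus\langle b_1,b_2\rangle=\langle a_1\sqcup b_1,a_2\sqcup b_2\rangle$, $\neg\langle a_1,a_2\rangle=\langle a_2,a_1\rangle$. The functor $F:\mathsf{Lat}\to\mathsf{IntBiLat}$ is $F(\mathbf L)=\mathbf L\odot\mathbf L$, $F(h)(\langle a,b\rangle)=\langle h(a),h(b)\rangle$. The functor $G:\mathsf{IntBiLat}\to\mathsf{Lat}$ is $G(\mathbf B)=\langle\mathrm{Reg}(\mathbf B),\otimes,\oplus\rangle$, $G(k)(a)=k(a)$. -}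

module Defs where

open import Algebra.Core using (Op₁; Op₂)
open import Algebra.Lattice.Bundles using (Lattice)
open import Algebra.Lattice.Morphism.Structures using (IsLatticeHomomorphism)
open import Algebra.Lattice.Structures using (IsLattice)
import Algebra.Definitions as AlgebraDefinitions
import Algebra.Lattice.Morphism.Construct.Composition as LatticeComposition
import Algebra.Lattice.Morphism.Construct.Identity as LatticeIdentity
import Algebra.Lattice.Properties.Lattice as LatticeProperties
import Algebra.Morphism.Definitions as MorphismDefinitions
open import Data.Product.Base using (Σ; Σ-syntax; _×_; _,_; proj₁; proj₂)
open import Function.Base using (id; _∘_)
open import Level using (Level; suc; _⊔_)
open import Relation.Binary.Bundles using (Poset)
open import Relation.Binary.Core using (Rel)
open import Relation.Binary.Definitions using (Monotonic₁; Antitonic₁; Monotonic₂)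
import Relation.Binary.Lattice as OrderLattice
import Relation.Binary.Lattice.Properties.JoinSemilattice as JoinProperties
import Relation.Binary.Lattice.Properties.MeetSemilattice as MeetProperties
open import Relation.Binary.Morphism.Structures using (IsRelHomomorphism)
open import Relation.Binary.Structures using (IsEquivalence)

-- Hom-sets carry an equivalence, so all equations between morphisms are
-- stated up to _≈_.

record Category o h e : Set (suc (o ⊔ h ⊔ e)) where
  infix  4 _⇒_ _≈_
  infixr 9 _∘′_
  field
    Obj           : Set o
    _⇒_           : Obj → Obj → Set h
    _≈_           : ∀ {A B} → Rel (A ⇒ B) e
    id′           : ∀ {A} → A ⇒ A
    _∘′_          : ∀ {A B C} → B ⇒ C → A ⇒ B → A ⇒ C
    isEquivalence : ∀ {A B} → IsEquivalence (_≈_ {A} {B})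
    ∘-cong        : ∀ {A B C} {f f′ : B ⇒ C} {g g′ : A ⇒ B} →
                    f ≈ f′ → g ≈ g′ → (f ∘′ g) ≈ (f′ ∘′ g′)
    identityˡ     : ∀ {A B} (f : A ⇒ B) → (id′ ∘′ f) ≈ f
    identityʳ     : ∀ {A B} (f : A ⇒ B) → (f ∘′ id′) ≈ f
    assoc         : ∀ {A B C D} (f : C ⇒ D) (g : B ⇒ C) (h : A ⇒ B) →
                    ((f ∘′ g) ∘′ h) ≈ (f ∘′ (g ∘′ h))

  record IsIso {A B : Obj} (f : A ⇒ B) : Set (h ⊔ e) where
    field
      inverse  : B ⇒ A
      inverseˡ : (inverse ∘′ f) ≈ id′
      inverseʳ : (f ∘′ inverse) ≈ id′

record Functor {o h e o′ h′ e′} (C : Category o h e) (D : Category o′ h′ e′)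
  : Set (o ⊔ h ⊔ e ⊔ o′ ⊔ h′ ⊔ e′) where
  private
    module C = Category C
    module D = Category D
  field
    F₀     : C.Obj → D.Obj
    F₁     : ∀ {A B} → A C.⇒ B → F₀ A D.⇒ F₀ B
    F-cong : ∀ {A B} {f g : A C.⇒ B} → f C.≈ g → F₁ f D.≈ F₁ g
    F-id   : ∀ {A} → F₁ (C.id′ {A}) D.≈ D.id′
    F-∘    : ∀ {A B C} (f : B C.⇒ C) (g : A C.⇒ B) →
             F₁ (f C.∘′ g) D.≈ (F₁ f D.∘′ F₁ g)

idF : ∀ {o h e} (C : Category o h e) → Functor C C
idF C = record
  { F₀     = id
  ; F₁     = id
  ; F-cong = id
  ; F-id   = IsEquivalence.refl isEquivalence
  ; F-∘    = λ _ _ → IsEquivalence.refl isEquivalence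
  } where open Category C

infixr 9 _∘F_
_∘F_ : ∀ {o h e o′ h′ e′ o″ h″ e″}
       {C : Category o h e} {D : Category o′ h′ e′} {E : Category o″ h″ e″} →
       Functor D E → Functor C D → Functor C E
_∘F_ {E = E} G F = record
  { F₀     = G.F₀ ∘ F.F₀
  ; F₁     = G.F₁ ∘ F.F₁
  ; F-cong = G.F-cong ∘ F.F-cong
  ; F-id   = trans (G.F-cong F.F-id) G.F-id
  ; F-∘    = λ f g → trans (G.F-cong (F.F-∘ f g)) (G.F-∘ (F.F₁ f) (F.F₁ g))
  } where
  module F = Functor F
  module G = Functor G
  open module E {A B} = IsEquivalence (Category.isEquivalence E {A} {B}) using (trans)

module _ {o h e o′ h′ e′} {C : Category o h e} {D : Category o′ h′ e′}
         (F G : Functor C D) where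
  private
    module C = Category C
    module D = Category D
    module F = Functor F
    module G = Functor G

  record IsNaturalIsomorphism (η : ∀ A → F.F₀ A D.⇒ G.F₀ A)
    : Set (o ⊔ h ⊔ h′ ⊔ e′) where
    field
      natural : ∀ {A B} (k : A C.⇒ B) →
                (η B D.∘′ F.F₁ k) D.≈ (G.F₁ k D.∘′ η A)
      isIso   : ∀ A → D.IsIso (η A)

  NaturallyIsomorphic : Set (o ⊔ h ⊔ h′ ⊔ e′)
  NaturallyIsomorphic = Σ[ η ∈ (∀ A → F.F₀ A D.⇒ G.F₀ A) ] IsNaturalIsomorphism η

NaturallyEquivalent : ∀ {o h e o′ h′ e′} → Category o h e → Category o′ h′ e′ →
                      Set (o ⊔ h ⊔ e ⊔ o′ ⊔ h′ ⊔ e′)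
NaturallyEquivalent C D =
  Σ[ F ∈ Functor C D ] Σ[ G ∈ Functor D C ]
    (NaturallyIsomorphic (idF D) (F ∘F G) × NaturallyIsomorphic (idF C) (G ∘F F))

record LatticeHomomorphism {c₁ ℓ₁ c₂ ℓ₂} (L : Lattice c₁ ℓ₁) (M : Lattice c₂ ℓ₂)
  : Set (c₁ ⊔ ℓ₁ ⊔ c₂ ⊔ ℓ₂) where
  constructor latticeHomomorphism
  private
    module L = Lattice L
    module M = Lattice M
  field
    ⟦_⟧                   : L.Carrier → M.Carrier
    isLatticeHomomorphism : IsLatticeHomomorphism L.rawLattice M.rawLattice ⟦_⟧

  open IsLatticeHomomorphism isLatticeHomomorphism public

Lat : ∀ c ℓ → Category (suc (c ⊔ ℓ)) (c ⊔ ℓ) (c ⊔ ℓ)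
Lat c ℓ = record
  { Obj           = Lattice c ℓ
  ; _⇒_           = LatticeHomomorphism
  ; _≈_           = λ {_} {M} f g → ∀ x → Lattice._≈_ M (⟦ f ⟧ x) (⟦ g ⟧ x)
  ; id′           = λ {L} → record
    { isLatticeHomomorphism =
        LatticeIdentity.isLatticeHomomorphism (Lattice.rawLattice L) (Lattice.refl L)
    }
  ; _∘′_          = λ {_} {_} {N} f g → record
    { isLatticeHomomorphism = LatticeComposition.isLatticeHomomorphism
        (Lattice.trans N) (isLatticeHomomorphism g) (isLatticeHomomorphism f)
    }
  ; isEquivalence = λ {_} {M} → record
    { refl  = λ _ → Lattice.refl M
    ; sym   = λ p x → Lattice.sym M (p x)
    ; trans = λ p q x → Lattice.trans M (p x) (q x)
    }
  ; ∘-cong        = λ {_} {_} {N} {f} {_} {_} {g′} p q x →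
      Lattice.trans N (⟦⟧-cong f (q x)) (p (⟦ g′ ⟧ x))
  ; identityˡ     = λ {_} {M} _ _ → Lattice.refl M
  ; identityʳ     = λ {_} {M} _ _ → Lattice.refl M
  ; assoc         = λ {_} {_} {_} {N} _ _ _ _ → Lattice.refl N
  } where open LatticeHomomorphism

record Bilattice c ℓ : Set (suc (c ⊔ ℓ)) where
  infix  8 ¬_
  infixr 7 _∧_ _⊗_
  infixr 6 _∨_ _⊕_
  infix  4 _≈_
  field
    Carrier     : Set c
    _≈_         : Rel Carrier ℓ
    _∧_ _∨_     : Op₂ Carrier
    _⊗_ _⊕_     : Op₂ Carrier
    ¬_          : Op₁ Carrier
    t-isLattice : IsLattice _≈_ _∨_ _∧_
    k-isLattice : IsLattice _≈_ _⊕_ _⊗_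

  t-lattice : Lattice c ℓ
  t-lattice = record { isLattice = t-isLattice }

  k-lattice : Lattice c ℓ
  k-lattice = record { isLattice = k-isLattice }

  -- The library's order of a lattice: a ≤ b means a ≈ a ∧ b.
  open Poset (LatticeProperties.poset t-lattice) public
    using () renaming (_≤_ to _≤ₜ_)
  open Poset (LatticeProperties.poset k-lattice) public
    using () renaming (_≤_ to _≤ₖ_)

  -- That ¬ respects _≈_ is not assumed: it follows from monotonicity (¬-cong).
  field
    ¬-antitonicₜ : Antitonic₁ _≤ₜ_ _≤ₜ_ ¬_
    ¬-monotonicₖ : Monotonic₁ _≤ₖ_ _≤ₖ_ ¬_
    ¬-involutive : AlgebraDefinitions.Involutive _≈_ ¬_

  open IsLattice k-isLattice public
    using (isEquivalence; refl; sym; trans)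
    renaming ( ∧-cong to ⊗-cong; ∧-comm to ⊗-comm; ∧-assoc to ⊗-assoc
             ; ∨-cong to ⊕-cong; ∨-comm to ⊕-comm; ∨-assoc to ⊕-assoc
             ; absorptive to ⊕-⊗-absorptive)
  open IsLattice t-isLattice public using (∧-cong; ∨-cong)

  private
    module K = OrderLattice.Lattice
      (LatticeProperties.∨-∧-orderTheoreticLattice k-lattice)
      renaming (∧-greatest to ⊗-greatest; ∨-least to ⊕-least)

    ¬-swap : ∀ {a b} → ¬ a ≤ₖ b → a ≤ₖ ¬ b
    ¬-swap p = K.≤-respˡ-≈ (¬-involutive _) (¬-monotonicₖ p)

    ¬-swap′ : ∀ {a b} → a ≤ₖ ¬ b → ¬ a ≤ₖ b
    ¬-swap′ p = K.≤-respʳ-≈ (¬-involutive _) (¬-monotonicₖ p)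

  ¬-cong : ∀ {a b} → a ≈ b → ¬ a ≈ ¬ b
  ¬-cong p = K.antisym (¬-monotonicₖ (K.reflexive p)) (¬-monotonicₖ (K.reflexive (sym p)))

  ¬-⊗ : ∀ a b → ¬ (a ⊗ b) ≈ ¬ a ⊗ ¬ b
  ¬-⊗ a b = K.antisym
    (K.⊗-greatest (¬-monotonicₖ (K.x∧y≤x a b)) (¬-monotonicₖ (K.x∧y≤y a b)))
    (¬-swap (K.⊗-greatest (¬-swap′ (K.x∧y≤x (¬ a) (¬ b))) (¬-swap′ (K.x∧y≤y (¬ a) (¬ b)))))

  ¬-⊕ : ∀ a b → ¬ (a ⊕ b) ≈ ¬ a ⊕ ¬ b
  ¬-⊕ a b = K.antisym
    (¬-swap′ (K.⊕-least (¬-swap (K.x≤x∨y (¬ a) (¬ b))) (¬-swap (K.y≤x∨y (¬ a) (¬ b)))))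
    (K.⊕-least (¬-monotonicₖ (K.x≤x∨y a b)) (¬-monotonicₖ (K.y≤x∨y a b)))

record InterlacedBilattice c ℓ : Set (suc (c ⊔ ℓ)) where
  field
    bilattice : Bilattice c ℓ

  open Bilattice bilattice public

  field
    ∧-monotonicₜ : Monotonic₂ _≤ₜ_ _≤ₜ_ _≤ₜ_ _∧_
    ∨-monotonicₜ : Monotonic₂ _≤ₜ_ _≤ₜ_ _≤ₜ_ _∨_
    ⊗-monotonicₜ : Monotonic₂ _≤ₜ_ _≤ₜ_ _≤ₜ_ _⊗_
    ⊕-monotonicₜ : Monotonic₂ _≤ₜ_ _≤ₜ_ _≤ₜ_ _⊕_
    ∧-monotonicₖ : Monotonic₂ _≤ₖ_ _≤ₖ_ _≤ₖ_ _∧_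
    ∨-monotonicₖ : Monotonic₂ _≤ₖ_ _≤ₖ_ _≤ₖ_ _∨_
    ⊗-monotonicₖ : Monotonic₂ _≤ₖ_ _≤ₖ_ _≤ₖ_ _⊗_
    ⊕-monotonicₖ : Monotonic₂ _≤ₖ_ _≤ₖ_ _≤ₖ_ _⊕_

module _ {c₁ ℓ₁ c₂ ℓ₂} (A : InterlacedBilattice c₁ ℓ₁) (B : InterlacedBilattice c₂ ℓ₂) where
  private
    module A = InterlacedBilattice A
    module B = InterlacedBilattice B
  open MorphismDefinitions A.Carrier B.Carrier B._≈_

  record IsBilatticeHomomorphism (⟦_⟧ : A.Carrier → B.Carrier) : Set (c₁ ⊔ ℓ₁ ⊔ ℓ₂) where
    field
      isRelHomomorphism : IsRelHomomorphism A._≈_ B._≈_ ⟦_⟧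
      ∧-homo            : Homomorphic₂ ⟦_⟧ A._∧_ B._∧_
      ∨-homo            : Homomorphic₂ ⟦_⟧ A._∨_ B._∨_
      ⊗-homo            : Homomorphic₂ ⟦_⟧ A._⊗_ B._⊗_
      ⊕-homo            : Homomorphic₂ ⟦_⟧ A._⊕_ B._⊕_
      ¬-homo            : Homomorphic₁ ⟦_⟧ A.¬_ B.¬_

    open IsRelHomomorphism isRelHomomorphism public renaming (cong to ⟦⟧-cong)

  record BilatticeHomomorphism : Set (c₁ ⊔ ℓ₁ ⊔ c₂ ⊔ ℓ₂) where
    constructor bilatticeHomomorphism
    field
      ⟦_⟧                     : A.Carrier → B.Carrier
      isBilatticeHomomorphism : IsBilatticeHomomorphism ⟦_⟧

    open IsBilatticeHomomorphism isBilatticeHomomorphism public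

IntBiLat : ∀ c ℓ → Category (suc (c ⊔ ℓ)) (c ⊔ ℓ) (c ⊔ ℓ)
IntBiLat c ℓ = record
  { Obj           = InterlacedBilattice c ℓ
  ; _⇒_           = BilatticeHomomorphism
  ; _≈_           = λ {_} {B} f g → ∀ x → I._≈_ B (⟦ f ⟧ x) (⟦ g ⟧ x)
  ; id′           = λ {A} → record
    { ⟦_⟧ = id
    ; isBilatticeHomomorphism = record
      { isRelHomomorphism = record { cong = id }
      ; ∧-homo            = λ _ _ → I.refl A
      ; ∨-homo            = λ _ _ → I.refl A
      ; ⊗-homo            = λ _ _ → I.refl A
      ; ⊕-homo            = λ _ _ → I.refl A
      ; ¬-homo            = λ _ → I.refl A
      }
    }
  ; _∘′_          = λ {_} {_} {C} f g → record
    { ⟦_⟧ = ⟦ f ⟧ ∘ ⟦ g ⟧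
    ; isBilatticeHomomorphism = record
      { isRelHomomorphism = record { cong = ⟦⟧-cong f ∘ ⟦⟧-cong g }
      ; ∧-homo            = λ x y → I.trans C (⟦⟧-cong f (∧-homo g x y)) (∧-homo f _ _)
      ; ∨-homo            = λ x y → I.trans C (⟦⟧-cong f (∨-homo g x y)) (∨-homo f _ _)
      ; ⊗-homo            = λ x y → I.trans C (⟦⟧-cong f (⊗-homo g x y)) (⊗-homo f _ _)
      ; ⊕-homo            = λ x y → I.trans C (⟦⟧-cong f (⊕-homo g x y)) (⊕-homo f _ _)
      ; ¬-homo            = λ x → I.trans C (⟦⟧-cong f (¬-homo g x)) (¬-homo f _)
      }
    }
  ; isEquivalence = λ {_} {B} → record
    { refl  = λ _ → I.refl B
    ; sym   = λ p x → I.sym B (p x)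
    ; trans = λ p q x → I.trans B (p x) (q x)
    }
  ; ∘-cong        = λ {_} {_} {C} {f} {_} {_} {g′} p q x →
      I.trans C (⟦⟧-cong f (q x)) (p (⟦ g′ ⟧ x))
  ; identityˡ     = λ {_} {B} _ _ → I.refl B
  ; identityʳ     = λ {_} {B} _ _ → I.refl B
  ; assoc         = λ {_} {_} {_} {D} _ _ _ _ → I.refl D
  } where
  open BilatticeHomomorphism
  module I = InterlacedBilattice

private
  module Order {c ℓ} (L : Lattice c ℓ) where
    open Lattice L using (_∧_; _∨_)
    open OrderLattice.Lattice (LatticeProperties.∨-∧-orderTheoreticLattice L)
      using (_≤_; joinSemilattice; meetSemilattice)

    ∧-monotonic : Monotonic₂ _≤_ _≤_ _≤_ _∧_
    ∧-monotonic = MeetProperties.∧-monotonic meetSemilattice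

    ∨-monotonic : Monotonic₂ _≤_ _≤_ _≤_ _∨_
    ∨-monotonic = JoinProperties.∨-monotonic joinSemilattice

module _ {c ℓ} (L : Lattice c ℓ) where
  private
    module L = Lattice L
    module O = Order L
    module Oᵒ = Order (LatticeProperties.∧-∨-lattice L)

  -- L ⊙ L; each truth operation acts dually on the second coordinate.
  square : InterlacedBilattice c ℓ
  square = record
    { bilattice = record
      { Carrier = L.Carrier × L.Carrier
      ; _≈_ = λ (a₁ , a₂) (b₁ , b₂) → a₁ L.≈ b₁ × a₂ L.≈ b₂
      ; _∧_ = λ (a₁ , a₂) (b₁ , b₂) → (a₁ L.∧ b₁) , (a₂ L.∨ b₂)
      ; _∨_ = λ (a₁ , a₂) (b₁ , b₂) → (a₁ L.∨ b₁) , (a₂ L.∧ b₂)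
      ; _⊗_ = λ (a₁ , a₂) (b₁ , b₂) → (a₁ L.∧ b₁) , (a₂ L.∧ b₂)
      ; _⊕_ = λ (a₁ , a₂) (b₁ , b₂) → (a₁ L.∨ b₁) , (a₂ L.∨ b₂)
      ; ¬_  = λ (a₁ , a₂) → a₂ , a₁
      ; t-isLattice = record
        { isEquivalence = isEquivalence
        ; ∨-comm     = λ _ _ → L.∨-comm _ _ , L.∧-comm _ _
        ; ∨-assoc    = λ _ _ _ → L.∨-assoc _ _ _ , L.∧-assoc _ _ _
        ; ∨-cong     = λ (p₁ , p₂) (q₁ , q₂) → L.∨-cong p₁ q₁ , L.∧-cong p₂ q₂
        ; ∧-comm     = λ _ _ → L.∧-comm _ _ , L.∨-comm _ _
        ; ∧-assoc    = λ _ _ _ → L.∧-assoc _ _ _ , L.∨-assoc _ _ _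
        ; ∧-cong     = λ (p₁ , p₂) (q₁ , q₂) → L.∧-cong p₁ q₁ , L.∨-cong p₂ q₂
        ; absorptive = (λ _ _ → L.∨-absorbs-∧ _ _ , L.∧-absorbs-∨ _ _)
                     , (λ _ _ → L.∧-absorbs-∨ _ _ , L.∨-absorbs-∧ _ _)
        }
      ; k-isLattice = record
        { isEquivalence = isEquivalence
        ; ∨-comm     = λ _ _ → L.∨-comm _ _ , L.∨-comm _ _
        ; ∨-assoc    = λ _ _ _ → L.∨-assoc _ _ _ , L.∨-assoc _ _ _
        ; ∨-cong     = λ (p₁ , p₂) (q₁ , q₂) → L.∨-cong p₁ q₁ , L.∨-cong p₂ q₂
        ; ∧-comm     = λ _ _ → L.∧-comm _ _ , L.∧-comm _ _
        ; ∧-assoc    = λ _ _ _ → L.∧-assoc _ _ _ , L.∧-assoc _ _ _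
        ; ∧-cong     = λ (p₁ , p₂) (q₁ , q₂) → L.∧-cong p₁ q₁ , L.∧-cong p₂ q₂
        ; absorptive = (λ _ _ → L.∨-absorbs-∧ _ _ , L.∨-absorbs-∧ _ _)
                     , (λ _ _ → L.∧-absorbs-∨ _ _ , L.∧-absorbs-∨ _ _)
        }
      ; ¬-antitonicₜ = λ (p₁ , p₂) → flip-≤ p₂ , flip-≥ p₁
      ; ¬-monotonicₖ = λ (p₁ , p₂) → p₂ , p₁
      ; ¬-involutive = λ _ → L.refl , L.refl
      }
    ; ∧-monotonicₜ = λ (p₁ , p₂) (q₁ , q₂) → O.∧-monotonic p₁ q₁ , Oᵒ.∧-monotonic p₂ q₂
    ; ∨-monotonicₜ = λ (p₁ , p₂) (q₁ , q₂) → O.∨-monotonic p₁ q₁ , Oᵒ.∨-monotonic p₂ q₂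
    ; ⊗-monotonicₜ = λ (p₁ , p₂) (q₁ , q₂) → O.∧-monotonic p₁ q₁ , Oᵒ.∨-monotonic p₂ q₂
    ; ⊕-monotonicₜ = λ (p₁ , p₂) (q₁ , q₂) → O.∨-monotonic p₁ q₁ , Oᵒ.∧-monotonic p₂ q₂
    ; ∧-monotonicₖ = λ (p₁ , p₂) (q₁ , q₂) → O.∧-monotonic p₁ q₁ , O.∨-monotonic p₂ q₂
    ; ∨-monotonicₖ = λ (p₁ , p₂) (q₁ , q₂) → O.∨-monotonic p₁ q₁ , O.∧-monotonic p₂ q₂
    ; ⊗-monotonicₖ = λ (p₁ , p₂) (q₁ , q₂) → O.∧-monotonic p₁ q₁ , O.∧-monotonic p₂ q₂
    ; ⊕-monotonicₖ = λ (p₁ , p₂) (q₁ , q₂) → O.∨-monotonic p₁ q₁ , O.∨-monotonic p₂ q₂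
    } where
    isEquivalence : IsEquivalence {A = L.Carrier × L.Carrier}
                      (λ (a₁ , a₂) (b₁ , b₂) → a₁ L.≈ b₁ × a₂ L.≈ b₂)
    isEquivalence = record
      { refl  = L.refl , L.refl
      ; sym   = λ (p₁ , p₂) → L.sym p₁ , L.sym p₂
      ; trans = λ (p₁ , p₂) (q₁ , q₂) → L.trans p₁ q₁ , L.trans p₂ q₂
      }

    flip-≤ : ∀ {a b} → b L.≈ b L.∨ a → a L.≈ a L.∧ b
    flip-≤ {a} {b} p = L.sym (L.trans (L.∧-congˡ (L.trans p (L.∨-comm b a))) (L.∧-absorbs-∨ a b))

    flip-≥ : ∀ {a b} → b L.≈ b L.∧ a → a L.≈ a L.∨ b
    flip-≥ {a} {b} p = L.sym (L.trans (L.∨-congˡ (L.trans p (L.∧-comm b a))) (L.∨-absorbs-∧ a b))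

-- F and G are functors between categories at the same levels: Reg B consists
-- of elements paired with an equality proof, so its carrier lives in c ⊔ ℓ,
-- and taking all carriers in c ⊔ ℓ makes this closed.

F : ∀ c ℓ → Functor (Lat (c ⊔ ℓ) ℓ) (IntBiLat (c ⊔ ℓ) ℓ)
F c ℓ = record
  { F₀     = square
  ; F₁     = λ h → let open LatticeHomomorphism h in record
    { ⟦_⟧ = λ (a , b) → ⟦ a ⟧ , ⟦ b ⟧
    ; isBilatticeHomomorphism = record
      { isRelHomomorphism = record { cong = λ (p , q) → ⟦⟧-cong p , ⟦⟧-cong q }
      ; ∧-homo            = λ _ _ → ∧-homo _ _ , ∨-homo _ _
      ; ∨-homo            = λ _ _ → ∨-homo _ _ , ∧-homo _ _
      ; ⊗-homo            = λ _ _ → ∧-homo _ _ , ∧-homo _ _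
      ; ⊕-homo            = λ _ _ → ∨-homo _ _ , ∨-homo _ _
      ; ¬-homo            = λ (a , b) → ⟦⟧-refl h b , ⟦⟧-refl h a
      }
    }
  ; F-cong = λ p (a , b) → p a , p b
  ; F-id   = λ {L} _ → Lattice.refl L , Lattice.refl L
  ; F-∘    = λ {_} {_} {N} _ _ _ → Lattice.refl N , Lattice.refl N
  } where
  ⟦⟧-refl : ∀ {L M : Lattice (c ⊔ ℓ) ℓ} (h : LatticeHomomorphism L M) a →
            let open LatticeHomomorphism h in Lattice._≈_ M ⟦ a ⟧ ⟦ a ⟧
  ⟦⟧-refl {M = M} _ _ = Lattice.refl M

module _ {c ℓ} (B : InterlacedBilattice c ℓ) where
  open InterlacedBilattice B

  Reg : Set (c ⊔ ℓ)
  Reg = Σ[ a ∈ Carrier ] a ≈ ¬ a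

  regLattice : Lattice (c ⊔ ℓ) ℓ
  regLattice = record
    { Carrier   = Reg
    ; _≈_       = λ (a , _) (b , _) → a ≈ b
    ; _∧_       = λ (a , p) (b , q) → a ⊗ b , trans (⊗-cong p q) (sym (¬-⊗ a b))
    ; _∨_       = λ (a , p) (b , q) → a ⊕ b , trans (⊕-cong p q) (sym (¬-⊕ a b))
    ; isLattice = record
      { isEquivalence = record { refl = refl ; sym = sym ; trans = trans }
      ; ∨-comm        = λ _ _ → ⊕-comm _ _
      ; ∨-assoc       = λ _ _ _ → ⊕-assoc _ _ _
      ; ∨-cong        = ⊕-cong
      ; ∧-comm        = λ _ _ → ⊗-comm _ _
      ; ∧-assoc       = λ _ _ _ → ⊗-assoc _ _ _
      ; ∧-cong        = ⊗-cong
      ; absorptive    = (λ _ _ → proj₁ ⊕-⊗-absorptive _ _)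
                      , (λ _ _ → proj₂ ⊕-⊗-absorptive _ _)
      }
    }

  reg : Carrier → Carrier
  reg a = (a ∨ (a ⊗ ¬ a)) ⊕ ¬ (a ∨ (a ⊗ ¬ a))

  reg-regular : ∀ a → reg a ≈ ¬ reg a
  reg-regular a = sym (trans (¬-⊕ x (¬ x)) (trans (⊕-cong refl (¬-involutive x)) (⊕-comm (¬ x) x)))
    where x = a ∨ (a ⊗ ¬ a)

G : ∀ c ℓ → Functor (IntBiLat (c ⊔ ℓ) ℓ) (Lat (c ⊔ ℓ) ℓ)
G c ℓ = record
  { F₀     = regLattice
  ; F₁     = λ {_} {B} k → let open BilatticeHomomorphism k in record
    { ⟦_⟧ = λ (a , p) → ⟦ a ⟧ , InterlacedBilattice.trans B (⟦⟧-cong p) (¬-homo a)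
    ; isLatticeHomomorphism = record
      { isRelHomomorphism = record { cong = ⟦⟧-cong }
      ; ∧-homo            = λ _ _ → ⊗-homo _ _
      ; ∨-homo            = λ _ _ → ⊕-homo _ _
      }
    }
  ; F-cong = λ p (a , _) → p a
  ; F-id   = λ {B} _ → InterlacedBilattice.refl B
  ; F-∘    = λ {_} {_} {B} _ _ _ → InterlacedBilattice.refl B
  }

f : ∀ c ℓ (B : InterlacedBilattice (c ⊔ ℓ) ℓ) →
    InterlacedBilattice.Carrier B →
    InterlacedBilattice.Carrier (Functor.F₀ (F c ℓ ∘F G c ℓ) B)
f c ℓ B a = (reg B a , reg-regular B a) , (reg B (¬ a) , reg-regular B (¬ a))
  where open InterlacedBilattice B using (¬_)

g : ∀ c ℓ (L : Lattice (c ⊔ ℓ) ℓ) →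
    Lattice.Carrier L →
    Lattice.Carrier (Functor.F₀ (G c ℓ ∘F F c ℓ) L)
g c ℓ L a = (a , a) , (Lattice.refl L , Lattice.refl L)

{-# OPTIONS --safe #-}
-- Call a below b in the first coordinate, a ⊑ b, when a ≤ₜ a ⊗ b; by
-- interlacing this is the same as a ≤ₖ a ∧ b. It is a preorder in which ⊗ and ∧
-- are both meets and ⊕ and ∨ both joins, so its equivalence _≋_ gives a lattice
-- in which the truth and the knowledge operations coincide. Moreover a ≋ b and
-- ¬ a ≋ ¬ b imply a ≈ b, so every equation in B can be checked in that lattice,
-- once for a and once for ¬ a. Since reg a is the regular element with
-- reg a ≋ a, this makes f_B a homomorphism. Its inverse sends ⟨p , q⟩ to the
-- element with the first coordinate of p and the second coordinate of q.
module Submission where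

open import Algebra.Lattice.Bundles using (Lattice)
open import Algebra.Lattice.Morphism.Structures using (IsLatticeHomomorphism)
import Algebra.Lattice.Properties.Lattice as LatticeProperties
open import Data.Product.Base using (Σ-syntax; _×_; _,_; proj₁; proj₂; swap)
open import Level using (Level; _⊔_)
open import Relation.Binary.Core using (Rel)
open import Relation.Binary.Definitions using (Transitive)
import Relation.Binary.Lattice as OrderLattice
import Relation.Binary.Lattice.Properties.JoinSemilattice as JoinProperties
import Relation.Binary.Lattice.Properties.Lattice as OrderLatticeProperties
open import Defs

module FirstCoordinate {c ℓ} (B : InterlacedBilattice c ℓ) where
  open InterlacedBilattice B

  private
    module T = OrderLattice.Lattice
      (LatticeProperties.∨-∧-orderTheoreticLattice t-lattice)
    module TJ = JoinProperties T.joinSemilattice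
    module K = OrderLattice.Lattice
      (LatticeProperties.∨-∧-orderTheoreticLattice k-lattice)
    module KJ = JoinProperties K.joinSemilattice

  -- De Morgan laws for the truth order

  ¬-∧ : ∀ a b → ¬ (a ∧ b) ≈ ¬ a ∨ ¬ b
  ¬-∧ a b = T.antisym
    (T.≤-respʳ-≈ (¬-involutive _) (¬-antitonicₜ (T.∧-greatest
      (T.≤-respʳ-≈ (¬-involutive a) (¬-antitonicₜ (T.x≤x∨y (¬ a) (¬ b))))
      (T.≤-respʳ-≈ (¬-involutive b) (¬-antitonicₜ (T.y≤x∨y (¬ a) (¬ b)))))))
    (T.∨-least (¬-antitonicₜ (T.x∧y≤x a b)) (¬-antitonicₜ (T.x∧y≤y a b)))

  ¬-∨ : ∀ a b → ¬ (a ∨ b) ≈ ¬ a ∧ ¬ b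
  ¬-∨ a b = sym (trans (sym (¬-involutive _))
    (¬-cong (trans (¬-∧ (¬ a) (¬ b)) (∨-cong (¬-involutive a) (¬-involutive b)))))

  -- The preorder of first coordinates

  infix 4 _⊑_ _≋_

  _⊑_ : Rel Carrier ℓ
  a ⊑ b = a ≤ₜ a ⊗ b

  _≋_ : Rel Carrier ℓ
  a ≋ b = a ⊑ b × b ⊑ a

  ⊑⇒≤ₖ-∧ : ∀ {a b} → a ⊑ b → a ≤ₖ a ∧ b
  -- Orders unfold to equations: `p` is `a ≈ a ∧ (a ⊗ b)`, so raising `a ⊗ b` to `b` in the
  -- knowledge order suffices.
  ⊑⇒≤ₖ-∧ p = K.≤-respˡ-≈ (sym p) (∧-monotonicₖ K.refl (K.x∧y≤y _ _))

  ≤ₖ-∧⇒⊑ : ∀ {a b} → a ≤ₖ a ∧ b → a ⊑ b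
  ≤ₖ-∧⇒⊑ p = T.≤-respˡ-≈ (sym p) (⊗-monotonicₜ T.refl (T.x∧y≤y _ _))

  -- Joining both sides of `a ≤ₜ a ⊗ b` with `b` absorbs the right side. This join form of `_⊑_` is
  -- what `⊕-least` iterates.
  ⊑⇒⊕-≤ₜ : ∀ {a b} → a ⊑ b → a ⊕ b ≤ₜ b
  ⊑⇒⊕-≤ₜ p = T.≤-respʳ-≈ (KJ.x≤y⇒x∨y≈y (K.x∧y≤y _ _)) (⊕-monotonicₜ p T.refl)

  ⊕-≤ₜ⇒⊑ : ∀ {a b} → a ⊕ b ≤ₜ b → a ⊑ b
  ⊕-≤ₜ⇒⊑ p = T.≤-respˡ-≈ (proj₂ ⊕-⊗-absorptive _ _) (⊗-monotonicₜ T.refl p)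

  ⊑⇒∨-≤ₖ : ∀ {a b} → a ⊑ b → a ∨ b ≤ₖ b
  ⊑⇒∨-≤ₖ p = K.≤-respʳ-≈ (TJ.x≤y⇒x∨y≈y (T.x∧y≤y _ _)) (∨-monotonicₖ (⊑⇒≤ₖ-∧ p) K.refl)

  ∨-≤ₖ⇒⊑ : ∀ {a b} → a ∨ b ≤ₖ b → a ⊑ b
  ∨-≤ₖ⇒⊑ p = ≤ₖ-∧⇒⊑
    (K.≤-respˡ-≈ (Lattice.∧-absorbs-∨ t-lattice _ _) (∧-monotonicₖ K.refl p))

  ≤ₖ⇒⊑ : ∀ {a b} → a ≤ₖ b → a ⊑ b
  ≤ₖ⇒⊑ = T.reflexive

  ≤ₜ⇒⊑ : ∀ {a b} → a ≤ₜ b → a ⊑ b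
  ≤ₜ⇒⊑ p = ≤ₖ-∧⇒⊑ (K.reflexive p)

  -- The middle term a ⊗ (b ⊗ c) is above a in the truth order and below a ⊗ c
  -- in the knowledge order, so ⊕ with a ⊗ c compares a with a ⊗ c.
  ⊑-trans : Transitive _⊑_
  ⊑-trans p q = T.≤-respˡ-≈ (KJ.x≤y⇒x∨y≈y (K.x∧y≤x _ _))
    (T.≤-respʳ-≈
      (trans (⊕-comm _ _)
        (KJ.x≤y⇒x∨y≈y (⊗-monotonicₖ K.refl (K.x∧y≤y _ _))))
      (⊕-monotonicₜ T.refl (T.trans p (⊗-monotonicₜ T.refl q))))

  ⊗-greatest : ∀ {a b d} → d ⊑ a → d ⊑ b → d ⊑ a ⊗ b
  ⊗-greatest p q = T.≤-respʳ-≈ (⊗-assoc _ _ _)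
    (T.trans q (⊗-monotonicₜ p T.refl))

  ⊕-least : ∀ {a b d} → a ⊑ d → b ⊑ d → a ⊕ b ⊑ d
  ⊕-least p q = ⊕-≤ₜ⇒⊑ (T.≤-respˡ-≈ (sym (⊕-assoc _ _ _))
    (T.trans (⊕-monotonicₜ T.refl (⊑⇒⊕-≤ₜ q)) (⊑⇒⊕-≤ₜ p)))

  ∧-greatest : ∀ {a b d} → d ⊑ a → d ⊑ b → d ⊑ a ∧ b
  ∧-greatest p q = ≤ₖ-∧⇒⊑ (K.≤-respʳ-≈ (Lattice.∧-assoc t-lattice _ _ _)
    (K.trans (⊑⇒≤ₖ-∧ q) (∧-monotonicₖ (⊑⇒≤ₖ-∧ p) K.refl)))

  ∨-least : ∀ {a b d} → a ⊑ d → b ⊑ d → a ∨ b ⊑ d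
  ∨-least p q = ∨-≤ₖ⇒⊑ (K.≤-respˡ-≈ (sym (Lattice.∨-assoc t-lattice _ _ _))
    (K.trans (∨-monotonicₖ K.refl (⊑⇒∨-≤ₖ q)) (⊑⇒∨-≤ₖ p)))

  -- The lattice modulo `_≋_` and equality from two coordinates

  lattice : OrderLattice.Lattice c ℓ ℓ
  lattice = record
    { _≈_       = _≋_
    ; _≤_       = _⊑_
    ; _∨_       = _⊕_
    ; _∧_       = _⊗_
    ; isLattice = record
      { isPartialOrder = record
        { isPreorder = record
          { isEquivalence = record
            { refl  = ≤ₖ⇒⊑ K.refl , ≤ₖ⇒⊑ K.refl
            ; sym   = swap
            ; trans = λ (p , p′) (q , q′) → ⊑-trans p q , ⊑-trans q′ p′
            }
          ; reflexive = proj₁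
          ; trans     = ⊑-trans
          }
        ; antisym = _,_
        }
      ; supremum = λ _ _ → ≤ₖ⇒⊑ (K.x≤x∨y _ _) , ≤ₖ⇒⊑ (K.y≤x∨y _ _) , λ _ → ⊕-least
      ; infimum  = λ _ _ → ≤ₖ⇒⊑ (K.x∧y≤x _ _) , ≤ₖ⇒⊑ (K.x∧y≤y _ _) , λ _ → ⊗-greatest
      }
    }

  private
    module L = OrderLattice.Lattice lattice
    module E = Lattice (OrderLatticeProperties.algLattice lattice)

  ≈⇒≋ : ∀ {a b} → a ≈ b → a ≋ b
  ≈⇒≋ p = ≤ₖ⇒⊑ (K.reflexive p) , ≤ₖ⇒⊑ (K.reflexive (sym p))

  ∧≋⊗ : ∀ a b → a ∧ b ≋ a ⊗ b
  ∧≋⊗ a b = ⊗-greatest (≤ₜ⇒⊑ (T.x∧y≤x a b)) (≤ₜ⇒⊑ (T.x∧y≤y a b))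
          , ∧-greatest (L.x∧y≤x a b) (L.x∧y≤y a b)

  ∨≋⊕ : ∀ a b → a ∨ b ≋ a ⊕ b
  ∨≋⊕ a b = ∨-least (L.x≤x∨y a b) (L.y≤x∨y a b)
          , ⊕-least (≤ₜ⇒⊑ (T.x≤x∨y a b)) (≤ₜ⇒⊑ (T.y≤x∨y a b))

  -- Negating the second hypothesis yields `a ⊗ b ≤ₜ a`. With the first, antisymmetry gives
  -- `a ≈ a ⊗ b`, which is `a ≤ₖ b`.
  ⊑-¬⊑⇒≤ₖ : ∀ {a b} → a ⊑ b → ¬ a ⊑ ¬ b → a ≤ₖ b
  ⊑-¬⊑⇒≤ₖ {a} {b} p q = T.antisym p
    (T.≤-respˡ-≈ (trans (¬-cong (sym (¬-⊗ a b))) (¬-involutive _))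
      (T.≤-respʳ-≈ (¬-involutive a) (¬-antitonicₜ q)))

  ≋-¬≋⇒≈ : ∀ {a b} → a ≋ b → ¬ a ≋ ¬ b → a ≈ b
  ≋-¬≋⇒≈ (p , p′) (q , q′) = K.antisym (⊑-¬⊑⇒≤ₖ p q) (⊑-¬⊑⇒≤ₖ p′ q′)

  -- In L ⊙ L, with a = ⟨a₁ , a₂⟩ and b = ⟨b₁ , b₂⟩, the two joinands are
  -- ⟨a₁ , a₂ ⊓ b₂⟩ and ⟨a₁ ⊓ b₁ , b₂⟩, so glue a b = ⟨a₁ , b₂⟩.
  glue : Carrier → Carrier → Carrier
  glue a b = (a ∨ (a ⊗ b)) ⊕ (b ∧ (a ⊗ b))

  -- Modulo `_≋_` the joinands become `a` and `a ⊗ b`, and absorption leaves `a`.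
  glue-≋ : ∀ a b → glue a b ≋ a
  glue-≋ a b = E.trans
    (E.∨-cong
      (E.trans (∨≋⊕ _ _) (E.∨-absorbs-∧ a b))
      (E.trans (∧≋⊗ _ _) (L.antisym (L.x∧y≤y b (a ⊗ b)) (L.∧-greatest (L.x∧y≤y a b) L.refl))))
    (E.∨-absorbs-∧ a b)

  -- De Morgan exchanges the roles of the two joinands, so second coordinates of `glue` reduce to
  -- `glue-≋`.
  ¬-glue : ∀ a b → ¬ glue a b ≈ glue (¬ b) (¬ a)
  ¬-glue a b = trans (¬-⊕ _ _) (trans (⊕-comm _ _) (⊕-cong
    (trans (¬-∧ _ _) (∨-cong refl ¬-⊗-comm))
    (trans (¬-∨ _ _) (∧-cong refl ¬-⊗-comm))))
    where
    ¬-⊗-comm : ¬ (a ⊗ b) ≈ ¬ b ⊗ ¬ a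
    ¬-⊗-comm = trans (¬-⊗ a b) (⊗-comm (¬ a) (¬ b))

  ¬-glue-≋ : ∀ a b → ¬ glue a b ≋ ¬ b
  ¬-glue-≋ a b = E.trans (≈⇒≋ (¬-glue a b)) (glue-≋ (¬ b) (¬ a))

  glue-unique : ∀ {a b x} → x ≋ a → ¬ x ≋ ¬ b → glue a b ≈ x
  glue-unique p q = ≋-¬≋⇒≈ (E.trans (glue-≋ _ _) (E.sym p)) (E.trans (¬-glue-≋ _ _) (E.sym q))

  -- Regular elements as first coordinates

  reg-≋ : ∀ a → reg B a ≋ a
  reg-≋ a = E.trans
    -- De Morgan rewrites `reg B a` as `glue a (¬ a)`.
    (≈⇒≋ (⊕-cong refl (trans (¬-∨ _ _) (∧-cong refl
      (trans (¬-⊗ _ _) (trans (⊗-cong refl (¬-involutive a)) (⊗-comm _ _)))))))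
    (glue-≋ a (¬ a))

  -- Both elements equal their own negations, so agreement in the first coordinate forces agreement
  -- in the second.
  reg-unique : (x : Reg B) → ∀ {a} → proj₁ x ≋ a → reg B a ≈ proj₁ x
  reg-unique (x , x≈¬x) {a} x≋a = ≋-¬≋⇒≈ r
    (E.trans (≈⇒≋ (sym (reg-regular B a))) (E.trans r (≈⇒≋ x≈¬x)))
    where
    r : reg B a ≋ x
    r = E.trans (reg-≋ a) (E.sym x≋a)

  toReg : Carrier → Reg B
  toReg a = reg B a , reg-regular B a

  private
    module R = Lattice (regLattice B)

  reg-cong : ∀ {a b} → a ≋ b → reg B a ≈ reg B b
  reg-cong p = reg-unique (toReg _) (E.trans (reg-≋ _) (E.sym p))

  -- Regular elements are closed under `⊗`, so `reg-unique` applies. Keeping `x` free up to `_≋_`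
  -- covers `a ∧ b` and negated joins too.
  reg-⊗ : ∀ {a b x} → x ≋ a ⊗ b → reg B x ≈ reg B a ⊗ reg B b
  reg-⊗ {a} {b} p = reg-unique (toReg a R.∧ toReg b)
    (E.trans (E.∧-cong (reg-≋ a) (reg-≋ b)) (E.sym p))

  reg-⊕ : ∀ {a b x} → x ≋ a ⊕ b → reg B x ≈ reg B a ⊕ reg B b
  reg-⊕ {a} {b} p = reg-unique (toReg a R.∨ toReg b)
    (E.trans (E.∨-cong (reg-≋ a) (reg-≋ b)) (E.sym p))

  -- The isomorphism with the square of the regular elements

  toSquare-isHomomorphism : IsBilatticeHomomorphism B (square (regLattice B))
                              (λ a → toReg a , toReg (¬ a))
  toSquare-isHomomorphism = record
    { isRelHomomorphism = record
      { cong = λ p → reg-cong (≈⇒≋ p) , reg-cong (≈⇒≋ (¬-cong p)) }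
    ; ∧-homo = λ a b → reg-⊗ (∧≋⊗ a b) , reg-⊕ (E.trans (≈⇒≋ (¬-∧ a b)) (∨≋⊕ _ _))
    ; ∨-homo = λ a b → reg-⊕ (∨≋⊕ a b) , reg-⊗ (E.trans (≈⇒≋ (¬-∨ a b)) (∧≋⊗ _ _))
    ; ⊗-homo = λ a b → reg-⊗ E.refl , reg-⊗ (≈⇒≋ (¬-⊗ a b))
    ; ⊕-homo = λ a b → reg-⊕ E.refl , reg-⊕ (≈⇒≋ (¬-⊕ a b))
    ; ¬-homo = λ a → refl , reg-cong (≈⇒≋ (¬-involutive a))
    }

  fromSquare : Reg B × Reg B → Carrier
  fromSquare ((x , _) , (y , _)) = glue x y

  fromSquare-toSquare : ∀ a → fromSquare (toReg a , toReg (¬ a)) ≈ a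
  fromSquare-toSquare a = glue-unique (E.sym (reg-≋ a))
    (E.trans (E.sym (reg-≋ (¬ a))) (≈⇒≋ (reg-regular B (¬ a))))

  toSquare-fromSquare : ∀ ((x , y) : Reg B × Reg B) → let z = fromSquare (x , y) in
    reg B z ≈ proj₁ x × reg B (¬ z) ≈ proj₁ y
  toSquare-fromSquare (x@(a , _) , y@(b , b≈¬b)) =
      reg-unique x (E.sym (glue-≋ a b))
    , reg-unique y (E.trans (≈⇒≋ b≈¬b) (E.sym (¬-glue-≋ a b)))

  fromSquare-cong : ∀ {x x′ y y′ : Reg B} → proj₁ x ≈ proj₁ x′ → proj₁ y ≈ proj₁ y′ →
                    fromSquare (x , y) ≈ fromSquare (x′ , y′)
  fromSquare-cong p q = ⊕-cong (∨-cong p (⊗-cong p q)) (∧-cong q (⊗-cong p q))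

-- Inverses of homomorphisms and preservation of `reg`

module _ {c₁ ℓ₁ c₂ ℓ₂} {A : InterlacedBilattice c₁ ℓ₁} {B : InterlacedBilattice c₂ ℓ₂}
         {h : InterlacedBilattice.Carrier A → InterlacedBilattice.Carrier B}
         (h-homo : IsBilatticeHomomorphism A B h) where
  private
    module A = InterlacedBilattice A
    module B = InterlacedBilattice B
    module H = IsBilatticeHomomorphism h-homo

  inverse-isHomomorphism :
    (k : B.Carrier → A.Carrier) → (∀ {x y} → x B.≈ y → k x A.≈ k y) →
    (∀ a → k (h a) A.≈ a) → (∀ b → h (k b) B.≈ b) → IsBilatticeHomomorphism B A k
  inverse-isHomomorphism k k-cong kh hk = record
    { isRelHomomorphism = record { cong = k-cong }
    ; ∧-homo = λ x y → lift (B.trans (H.∧-homo _ _) (B.∧-cong (hk x) (hk y)))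
    ; ∨-homo = λ x y → lift (B.trans (H.∨-homo _ _) (B.∨-cong (hk x) (hk y)))
    ; ⊗-homo = λ x y → lift (B.trans (H.⊗-homo _ _) (B.⊗-cong (hk x) (hk y)))
    ; ⊕-homo = λ x y → lift (B.trans (H.⊕-homo _ _) (B.⊕-cong (hk x) (hk y)))
    ; ¬-homo = λ x → lift (B.trans (H.¬-homo _) (B.¬-cong (hk x)))
    }
    where
    -- Each law for `k` is checked after applying `h`, then carried back through `k`.
    lift : ∀ {a x} → h a B.≈ x → k x A.≈ a
    lift p = A.trans (k-cong (B.sym p)) (kh _)

  reg-homo : ∀ a → h (reg A a) B.≈ reg B (h a)
  reg-homo a = B.trans (H.⊕-homo _ _)
    (B.⊕-cong x-homo (B.trans (H.¬-homo _) (B.¬-cong x-homo)))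
    where
    x-homo : h (a A.∨ (a A.⊗ A.¬ a)) B.≈ h a B.∨ (h a B.⊗ B.¬ h a)
    x-homo = B.trans (H.∨-homo _ _)
      (B.∨-cong B.refl (B.trans (H.⊗-homo _ _) (B.⊗-cong B.refl (H.¬-homo a))))

-- The two natural isomorphisms

module _ (c ℓ : Level) where
  f-isHomomorphism : ∀ B →
    IsBilatticeHomomorphism B (Functor.F₀ (F c ℓ ∘F G c ℓ) B) (f c ℓ B)
  f-isHomomorphism = FirstCoordinate.toSquare-isHomomorphism

  f-isNaturalIsomorphism :
    IsNaturalIsomorphism (idF (IntBiLat (c ⊔ ℓ) ℓ)) (F c ℓ ∘F G c ℓ)
      (λ B → bilatticeHomomorphism (f c ℓ B) (f-isHomomorphism B))
  f-isNaturalIsomorphism = record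
    { natural = λ {A} {B} (bilatticeHomomorphism k k-homo) a →
        let open InterlacedBilattice B
            open FirstCoordinate B
            open IsBilatticeHomomorphism k-homo
        in sym (reg-homo k-homo a)
         , sym (trans (reg-homo k-homo _) (reg-cong (≈⇒≋ (¬-homo a))))
    ; isIso = λ B → let open FirstCoordinate B in record
      { inverse  = bilatticeHomomorphism fromSquare
          (inverse-isHomomorphism toSquare-isHomomorphism fromSquare
            (λ {(x , y)} {(x′ , y′)} (p , q) → fromSquare-cong {x} {x′} {y} {y′} p q)
            fromSquare-toSquare toSquare-fromSquare)
      ; inverseˡ = fromSquare-toSquare
      ; inverseʳ = toSquare-fromSquare
      }
    }

  g-isHomomorphism : ∀ L →
    IsLatticeHomomorphism (Lattice.rawLattice L)
      (Lattice.rawLattice (Functor.F₀ (G c ℓ ∘F F c ℓ) L)) (g c ℓ L)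
  g-isHomomorphism L = record
    { isRelHomomorphism = record { cong = λ p → p , p }
    ; ∧-homo            = λ _ _ → L.refl , L.refl
    ; ∨-homo            = λ _ _ → L.refl , L.refl
    }
    where module L = Lattice L

  g-isNaturalIsomorphism :
    IsNaturalIsomorphism (idF (Lat (c ⊔ ℓ) ℓ)) (G c ℓ ∘F F c ℓ)
      (λ L → latticeHomomorphism (g c ℓ L) (g-isHomomorphism L))
  g-isNaturalIsomorphism = record
    { natural = λ {_} {M} _ _ → Lattice.refl M , Lattice.refl M
    ; isIso   = λ L → let open Lattice L in record
      -- Regularity of `(a , b)` in the square means `a ≈ b`, so either projection would invert the
      -- diagonal.
      { inverse  = latticeHomomorphism (λ ((a , _) , _) → a) (record
        { isRelHomomorphism = record { cong = proj₁ }
        ; ∧-homo            = λ _ _ → refl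
        ; ∨-homo            = λ _ _ → refl
        })
      ; inverseˡ = λ _ → refl
      ; inverseʳ = λ (_ , a≈b , _) → refl , a≈b
      }
    }

theorem5p6p3 : ∀ c ℓ →
    (Σ[ f-hom ∈ (∀ B → IsBilatticeHomomorphism B (Functor.F₀ (F c ℓ ∘F G c ℓ) B) (f c ℓ B)) ]
    IsNaturalIsomorphism (idF (IntBiLat (c ⊔ ℓ) ℓ)) (F c ℓ ∘F G c ℓ)
    (λ B → bilatticeHomomorphism (f c ℓ B) (f-hom B)))
    × (Σ[ g-hom ∈ (∀ L → IsLatticeHomomorphism (Lattice.rawLattice L) (Lattice.rawLattice (Functor.F₀ (G c ℓ ∘F F c ℓ) L)) (g c ℓ L)) ]
    IsNaturalIsomorphism (idF (Lat (c ⊔ ℓ) ℓ)) (G c ℓ ∘F F c ℓ)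
    (λ L → latticeHomomorphism (g c ℓ L) (g-hom L)))
    × NaturallyEquivalent (Lat (c ⊔ ℓ) ℓ) (IntBiLat (c ⊔ ℓ) ℓ)
theorem5p6p3 c ℓ =
    (f-isHomomorphism c ℓ , f-isNaturalIsomorphism c ℓ)
  , (g-isHomomorphism c ℓ , g-isNaturalIsomorphism c ℓ)
  , (F c ℓ , G c ℓ , (_ , f-isNaturalIsomorphism c ℓ) , (_ , g-isNaturalIsomorphism c ℓ))
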